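{- Let $k,\ell$ be positive integers. Then $\mu_k(A_\ell)\le \ell+1$. If $\ell>k4^k$, then \[ \mu_k(A_\ell)=\left\lfloor \frac{\ell+1-k}{k}\right\rfloor, \] and every SOS-clique $\mathcal{F}\subseteq SOS_k(A_\ell)$ with $|\mathcal{F}|=\mu_k(A_\ell)$ is a sunflower.
   Context: Let $\varepsilon_1,\ldots,\varepsilon_{\ell+1}$ be the standard basis of $\mathbb{R}^{\ell+1}$. The root system $A_\ell$ is the set of vectors $\varepsilon_i-\varepsilon_j$, $i\neq j$. Two roots are strongly orthogonal if neither their sum nor their difference is a root (equivalently, in $A_\ell$, their supports are disjoint). $SOS_k(A_\ell)$ is the set of $k$-element subsets $\Gamma$ of $A_\ell$ whose elements are pairwise strongly orthogonal. For $\Gamma\in SOS_k(A_\ell)$ write $|\Gamma|=\sum_{\gamma\in\Gamma}\gamma\in\mathbb{R}^{\ell+1}$. A subset $\mathcal{F}\subseteq SOS_k(A_\ell)$ is an SOS-clique if for all distinct $\Gamma_i,\Gamma_j\in\mathcal{F}$ there exists $\Gamma_{i,j}\in SOS_k(A_\ell)$ with $|\Gamma_i|-|\Gamma_j|=|\Gamma_{i,j}|$. $\mu_k(A_\ell)$ denotes the maximum size of an SOS-clique in $SOS_k(A_\ell)$ (taken to be $0$ if $SOS_k(A_\ell)$ is empty). For $\Gamma,\Gamma'$ write $S(\Gamma,\Gamma')$ for the set of coordinates in which both $|\Gamma|$ and $|\Gamma'|$ are nonzero. An SOS-clique $\mathcal{F}$ is a sunflower if the sets $S(\Gamma_i,\Gamma_j)$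 are the same for all pairs of distinct $\Gamma_i,\Gamma_j\in\mathcal{F}$. -}

module Defs where

open import Data.Nat using (ℕ; suc; _≤_)
open import Data.Integer using (ℤ; +_; _-_; _+_)
open import Data.Fin using (Fin; _≟_)
open import Data.Product using (_×_; Σ; ∃; _,_)
open import Data.List using (List; []; _∷_; length; lookup)
open import Data.List.Relation.Unary.All using (All)
open import Data.List.Relation.Unary.AllPairs using (AllPairs)
open import Data.List.Membership.Propositional using (_∈_)
open import Relation.Binary.PropositionalEquality using (_≡_; _≢_)
open import Relation.Nullary using (¬_; does)
open import Data.Bool using (if_then_else_)
open import Function.Bundles using (_⇔_)

-- Coordinates of ℝ^(ℓ+1) are indexed by Fin (suc ℓ); we work with integer
-- vectors (all vectors involved are integral), represented as functions.
Vec' : ℕ → Set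
Vec' n = Fin n → ℤ

ε : ∀ {n} → Fin n → Vec' n
ε i c = if does (c ≟ i) then + 1 else + 0

-- A (candidate) root ε_i - ε_j is given by the ordered pair (i , j);
-- it is a root of A_ℓ (n = ℓ+1) iff i ≢ j.
Root : ℕ → Set
Root n = Fin n × Fin n

IsRoot : ∀ {n} → Root n → Set
IsRoot (i , j) = i ≢ j

rootVec : ∀ {n} → Root n → Vec' n
rootVec (i , j) c = ε i c - ε j c

StronglyOrth : ∀ {n} → Root n → Root n → Set
StronglyOrth (i , j) (i' , j') =
  (i ≢ i') × (i ≢ j') × (j ≢ i') × (j ≢ j')

-- Γ ∈ SOS_k(A_ℓ), with n = ℓ+1: a list of roots, pairwise strongly orthogonal
-- (hence pairwise distinct), with exactly k elements.
record SOS (n k : ℕ) (Γ : List (Root n)) : Set where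
  field
    roots  : All IsRoot Γ
    sorth  : AllPairs StronglyOrth Γ
    card   : length Γ ≡ k

∣_∣ : ∀ {n} → List (Root n) → Vec' n
∣ [] ∣ c = + 0
∣ γ ∷ Γ ∣ c = rootVec γ c + ∣ Γ ∣ c

SameSet : ∀ {n} → List (Root n) → List (Root n) → Set
SameSet Γ Γ' = ∀ α → (α ∈ Γ) ⇔ (α ∈ Γ')

DiffRep : (n k : ℕ) → List (Root n) → List (Root n) → Set
DiffRep n k Γ Γ' = Σ (List (Root n)) λ Γ'' → SOS n k Γ'' × (∀ c → ∣ Γ ∣ c - ∣ Γ' ∣ c ≡ ∣ Γ'' ∣ c)

-- An SOS-clique in SOS_k(A_ℓ) (n = ℓ+1), given as a list of its members,
-- which are pairwise distinct as sets; its size is the length of the list.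
record SOSClique (n k : ℕ) (F : List (List (Root n))) : Set where
  field
    members  : All (SOS n k) F
    distinct : AllPairs (λ Γ Γ' → ¬ SameSet Γ Γ') F
    clique   : AllPairs (λ Γ Γ' → DiffRep n k Γ Γ' × DiffRep n k Γ' Γ) F

InS : ∀ {n} → List (Root n) → List (Root n) → Fin n → Set
InS Γ Γ' c = (∣ Γ ∣ c ≢ + 0) × (∣ Γ' ∣ c ≢ + 0)

Sunflower : ∀ {n} → List (List (Root n)) → Set
Sunflower F = ∀ (a b a' b' : Fin (length F)) → a ≢ b → a' ≢ b' →
  ∀ c → InS (lookup F a) (lookup F b) c ⇔ InS (lookup F a') (lookup F b') c

{-# OPTIONS --safe #-}

-- Let x_Γ = |Γ| ∈ {-1, 0, 1}^n with n = ℓ + 1. If x_Γ - x_Γ′ is again some |Γ″|, it has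
-- entries in {-1, 0, 1} and norm 2k, so the signs of x_Γ and x_Γ′ agree on their common
-- support, which therefore has k elements. A clique of size m thus gives m indicator
-- vectors y_i of 2k-sets meeting pairwise in k points, with Gram form
--   |Σ w_i y_i|² = k (Σ w_i² + (Σ w_i)²).
-- It is positive definite, hence the y_i are linearly independent and m ≤ n.
--
-- Testing the form on suitable weights shows that the degree a_c of a coordinate c
-- satisfies a_c (m - a_c) ≤ k m. For m ≥ k² + 2k + 2 this forces a_c ≤ k (light) or
-- a_c ≥ m - k (heavy); counting ⟨y_i , a⟩ = k (m + 1) then shows that each set has
-- exactly k heavy points and that there are only k of them. So the heavy points form the
-- kernel of a sunflower, and k + m k ≤ n. Since ⌊(n - k) / k⌋ ≥ k² + 2k + 2 as soon as
-- ℓ > k 4^k, this settles every clique at least that large.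

module Submission where

open import Defs
open import Data.Nat using (ℕ; zero; suc; NonZero)
open import Data.Nat.DivMod using (_/_; m/n*n≤m; m*n/n≡m; /-monoˡ-≤)
import Data.Nat as Nat
import Data.Nat.Properties as Natₚ
import Data.Nat.Tactic.RingSolver as NatSolver
open import Data.Integer using (ℤ; +_)
import Data.Integer as Int
import Data.Integer.Properties as Intₚ
open import Data.Integer.Tactic.RingSolver using (solve-∀)
open import Data.Fin using (Fin; zero; suc; _≟_; punchIn; combine; inject≤)
open import Data.Fin.Properties
  using (any?; punchInᵢ≢i; combine-injective; inject≤-injective; suc-injective)
open import Data.Vec.Functional using (insertAt; removeAt)
open import Data.Vec.Functional.Properties using (insertAt-lookup; insertAt-punchIn)
open import Data.List using (List; []; _∷_; length; lookup; tabulate)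
open import Data.List.Properties using (length-tabulate)
open import Data.List.Relation.Unary.All as All using (All; []; _∷_)
import Data.List.Relation.Unary.All.Properties as Allₚ
open import Data.List.Relation.Unary.AllPairs using (AllPairs; []; _∷_)
import Data.List.Relation.Unary.AllPairs.Properties as AllPairsₚ
open import Data.List.Membership.Propositional.Properties using (∈-lookup; ∈-tabulate⁺; ∈-tabulate⁻)
open import Data.Product using (_×_; Σ; ∃; _,_; proj₁; proj₂; swap)
open import Data.Sum using (_⊎_; inj₁; inj₂; [_,_])
open import Data.Empty using (⊥-elim)
open import Function using (_∘_; const)
open import Function.Bundles using (_⇔_; mk⇔; module Equivalence)
open import Relation.Binary using (Symmetric)
open import Relation.Binary.PropositionalEquality
  using (_≡_; _≢_; refl; sym; trans; cong; cong₂; subst; subst₂; module ≡-Reasoning)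
open import Relation.Nullary using (¬_; yes; no; ¬?)
open import Relation.Nullary.Decidable using (dec-true; dec-false; decidable-stable)
open import Algebra.Properties.Semiring.Sum Intₚ.+-*-semiring
  using (sum; sum-cong-≗; sum-replicate-zero; sum-remove; ∑-distrib-+; ∑-comm; *-distribˡ-sum; *-distribʳ-sum)

-- Integer inequalities for the light/heavy dichotomy and the heavy counts.

module Inequalities where

  open Int using (_≤_; _+_; _*_; _-_; -_)

  0≤+ : ∀ {a b} → + 0 ≤ a → + 0 ≤ b → + 0 ≤ a + b
  0≤+ = Intₚ.+-mono-≤

  0≤* : ∀ {a b} → + 0 ≤ a → + 0 ≤ b → + 0 ≤ a * b
  0≤* {+ a} {+ b} _ _ = subst (+ 0 ≤_) (Intₚ.pos-* a b) (Int.+≤+ Nat.z≤n)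

  0≤sq : ∀ a → + 0 ≤ a * a
  0≤sq (+ a)       = 0≤* {+ a} {+ a} (Int.+≤+ Nat.z≤n) (Int.+≤+ Nat.z≤n)
  0≤sq Int.-[1+ a ] = Int.+≤+ Nat.z≤n

  sq≡0⇒≡0 : ∀ a → a * a ≡ + 0 → a ≡ + 0
  sq≡0⇒≡0 a eq = [ (λ p → p) , (λ p → p) ] (Intₚ.i*j≡0⇒i≡0∨j≡0 a eq)

  ≤⇒0≤ : ∀ {a b} → a ≤ b → + 0 ≤ b - a
  ≤⇒0≤ = Intₚ.i≤j⇒0≤j-i

  0≤⇒≤ : ∀ {a b} → + 0 ≤ b - a → a ≤ b
  0≤⇒≤ = Intₚ.0≤i-j⇒j≤i

  ≰⇒1+≤ : ∀ {a b} → ¬ (a ≤ b) → + 1 + b ≤ a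
  ≰⇒1+≤ = Intₚ.i<j⇒suc[i]≤j ∘ Intₚ.≰⇒>

  -- Endpoint of the refutations below: a ring identity `cert` rewrites a sum of nonnegative terms
  -- as `- + 1 - a` with `a` nonnegative.
  ¬0≤-1-[_] : ∀ a → + 0 ≤ a → ¬ (+ 0 ≤ - + 1 - a)
  ¬0≤-1-[ + zero ] _ ()
  ¬0≤-1-[ + (suc a) ] _ ()

  -- (a - k) (b - k) ≤ k², while a - k and b - k are at least 1.
  no-medium : ∀ m a k → + 2 + k * (k + + 2) ≤ m →
              (m - a) * a ≤ k * m → a ≤ k ⊎ m - k ≤ a
  no-medium m a k big small with a Int.≤? k | m - k Int.≤? a
  ... | yes p | _     = inj₁ p
  ... | no _  | yes q = inj₂ q
  ... | no p  | no q  =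
    ⊥-elim (¬0≤-1-[ + 0 ] (Int.+≤+ Nat.z≤n) (subst (+ 0 ≤_) (cert m a k)
      (0≤+ (≤⇒0≤ big) (0≤+ (≤⇒0≤ small) (0≤* (≤⇒0≤ (≰⇒1+≤ p)) (≤⇒0≤ (≰⇒1+≤ q)))))))
    where
    cert : ∀ m a k →
      (m - (+ 2 + k * (k + + 2))) + ((k * m - (m - a) * a) +
      (a - (+ 1 + k)) * ((m - k) - (+ 1 + a))) ≡ - + 1 - + 0
    cert = solve-∀

  large⇒k≤m : ∀ m k → + 0 ≤ k → + 2 + k * (k + + 2) ≤ m → k ≤ m
  large⇒k≤m m k 0≤k big = 0≤⇒≤ (subst (+ 0 ≤_) (cert m k)
    (0≤+ (≤⇒0≤ big) (0≤+ (0≤* 0≤k 0≤k) (0≤+ 0≤k (Int.+≤+ (Nat.z≤n {2}))))))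
    where
    cert : ∀ m k → (m - (+ 2 + k * (k + + 2))) + (k * k + (k + + 2)) ≡ m - k
    cert = solve-∀

  -- If t were at least k + 1, then (m - k)(k + 1) ≤ k (1 + m), that is m ≤ k² + 2k, which lies
  -- below the threshold.
  heavy-count-≤ : ∀ m k t → + 0 ≤ k → + 2 + k * (k + + 2) ≤ m →
                  (m - k) * t ≤ k * (+ 1 + m) → t ≤ k
  heavy-count-≤ m k t 0≤k big h with t Int.≤? k
  ... | yes p = p
  ... | no p  =
    ⊥-elim (¬0≤-1-[ + 1 ] (Int.+≤+ Nat.z≤n) (subst (+ 0 ≤_) (cert m k t)
      (0≤+ (0≤* (≤⇒0≤ (large⇒k≤m m k 0≤k big)) (≤⇒0≤ (≰⇒1+≤ p))) (0≤+ (≤⇒0≤ h) (≤⇒0≤ big)))))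
    where
    cert : ∀ m k t →
      (m - k) * (t - (+ 1 + k)) + ((k * (+ 1 + m) - (m - k) * t) +
      (m - (+ 2 + k * (k + + 2)))) ≡ - + 1 - + 1
    cert = solve-∀

  -- If t were at most k - 1, the right-hand side would be at most 2k² + (m - k)(k - 1), and the
  -- inequality would collapse to m ≤ k².
  heavy-count-≥ : ∀ m k t → + 0 ≤ k → + 2 + k * (k + + 2) ≤ m →
                  k * (+ 1 + m) ≤ k * (+ 2 * k) + (m - k) * t → k ≤ t
  heavy-count-≥ m k t 0≤k big h with k Int.≤? t
  ... | yes p = p
  ... | no p  =
    ⊥-elim (¬0≤-1-[ + 1 + + 2 * k ] (0≤+ {+ 1} (Int.+≤+ Nat.z≤n) (0≤* {+ 2} (Int.+≤+ Nat.z≤n) 0≤k))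
      (subst (+ 0 ≤_) (cert m k t)
      (0≤+ (0≤* (≤⇒0≤ (large⇒k≤m m k 0≤k big)) (≤⇒0≤ (≰⇒1+≤ p))) (0≤+ (≤⇒0≤ h) (≤⇒0≤ big)))))
    where
    cert : ∀ m k t →
      (m - k) * (k - (+ 1 + t)) + ((k * (+ 2 * k) + (m - k) * t - k * (+ 1 + m)) +
      (m - (+ 2 + k * (k + + 2)))) ≡ - + 1 - (+ 1 + + 2 * k)
    cert = solve-∀

-- Finite sums of integers and linear dependence.

module Sums where

  open Int using (_≤_; _+_; _*_; _-_; -_)
  open Inequalities
  open ≡-Reasoning

  ∑-mono : ∀ {n} {f g : Vec' n} → (∀ i → f i ≤ g i) → sum f ≤ sum g
  ∑-mono {zero}  _ = Intₚ.≤-refl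
  ∑-mono {suc n} h = Intₚ.+-mono-≤ (h zero) (∑-mono (h ∘ suc))

  ∑-nonneg : ∀ {n} {f : Vec' n} → (∀ i → + 0 ≤ f i) → + 0 ≤ sum f
  ∑-nonneg {zero}  _ = Intₚ.≤-refl
  ∑-nonneg {suc n} h = 0≤+ (h zero) (∑-nonneg (h ∘ suc))

  term≤∑ : ∀ {n} {f : Vec' n} → (∀ i → + 0 ≤ f i) → ∀ i → f i ≤ sum f
  term≤∑ {suc n} {f} h i = subst (f i ≤_) (sym (sum-remove f))
    (subst (_≤ f i + sum (removeAt f i)) (Intₚ.+-identityʳ (f i))
      (Intₚ.+-monoʳ-≤ (f i) (∑-nonneg (λ j → h (punchIn i j)))))

  -- The passage from totals to single coordinates: each term lies between 0 and the whole sum.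
  ∑-nonneg-≤0 : ∀ {n} {f : Vec' n} → (∀ i → + 0 ≤ f i) → sum f ≤ + 0 → ∀ i → f i ≡ + 0
  ∑-nonneg-≤0 h s i = Intₚ.≤-antisym (Intₚ.≤-trans (term≤∑ h i) s) (h i)

  ∑-const : ∀ n x → sum {n} (const x) ≡ + n * x
  ∑-const zero    x = sym (Intₚ.*-zeroˡ x)
  ∑-const (suc n) x = begin
    x + sum {n} (const x) ≡⟨ cong (λ s → x + s) (∑-const n x) ⟩
    x + + n * x           ≡⟨ sym (Intₚ.suc-* (+ n) x) ⟩
    + suc n * x           ∎

  ∑-neg : ∀ {n} (f : Vec' n) → sum (λ i → - f i) ≡ - sum f
  ∑-neg {zero}  f = refl
  ∑-neg {suc n} f = trans (cong (λ s → - f zero + s) (∑-neg (f ∘ suc))) (sym (Intₚ.neg-distrib-+ (f zero) _))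

  ∑-sub : ∀ {n} (f g : Vec' n) → sum (λ i → f i - g i) ≡ sum f - sum g
  ∑-sub f g = trans (∑-distrib-+ f (λ i → - g i)) (cong (λ s → sum f + s) (∑-neg g))

  ∑-*ˡ : ∀ {n} x (f : Vec' n) → sum (λ i → x * f i) ≡ x * sum f
  ∑-*ˡ x f = sym (*-distribˡ-sum x f)

  ∑-*ʳ : ∀ {n} (f : Vec' n) x → sum (λ i → f i * x) ≡ sum f * x
  ∑-*ʳ f x = sym (*-distribʳ-sum x f)

  ∑-swap-* : ∀ {m n} (u : Vec' n) (f : Fin m → Vec' n) →
             sum (λ c → u c * sum (λ i → f i c)) ≡ sum (λ i → sum (λ c → u c * f i c))
  ∑-swap-* u f = trans (sum-cong-≗ (λ c → *-distribˡ-sum (u c) (λ i → f i c)))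
                       (∑-comm (λ c i → u c * f i c))

  ε-diag : ∀ {n} (i : Fin n) → ε i i ≡ + 1
  ε-diag i rewrite dec-true (i ≟ i) refl = refl

  ε-off : ∀ {n} {i c : Fin n} → c ≢ i → ε i c ≡ + 0
  ε-off {i = i} {c} c≢i rewrite dec-false (c ≟ i) c≢i = refl

  ∑-ε : ∀ {n} (f : Vec' n) i → sum (λ c → f c * ε i c) ≡ f i
  ∑-ε {suc n} f i = begin
    sum g                        ≡⟨ sum-remove g ⟩
    f i * ε i i + sum (removeAt g i)
      ≡⟨ cong₂ _+_ (trans (cong (f i *_) (ε-diag i)) (Intₚ.*-identityʳ (f i)))
           (trans (sum-cong-≗ off) (sum-replicate-zero n)) ⟩
    f i + + 0                    ≡⟨ Intₚ.+-identityʳ (f i) ⟩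
    f i                          ∎
    where
    g : Vec' (suc n)
    g c = f c * ε i c
    off : ∀ j → removeAt g i j ≡ + 0
    off j = trans (cong (f (punchIn i j) *_) (ε-off (punchInᵢ≢i i j))) (Intₚ.*-zeroʳ (f (punchIn i j)))

  LinearlyDependent : ∀ {m n} → (Fin m → Vec' n) → Set
  LinearlyDependent {m} M =
    Σ (Vec' m) λ w → ∃ (λ i → w i ≢ + 0) × (∀ c → sum (λ i → w i * M i c) ≡ + 0)

  -- Fraction-free Gaussian elimination on the first coordinate.
  more-vectors-than-coordinates : ∀ {m} n → n Nat.< m → (M : Fin m → Vec' n) → LinearlyDependent M
  more-vectors-than-coordinates {suc m} zero    _ M = const (+ 1) , (zero , λ ()) , λ ()
  more-vectors-than-coordinates {suc m} (suc n) (Nat.s≤s n<m) M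
    with any? (λ i → ¬? (M i zero Int.≟ + 0))
  ... | no none = w , nz , λ { zero → first ; (suc c) → rel c }
    where
    -- The first coordinate is zero throughout, so it is dropped while all `suc m` vectors are kept.
    ih = more-vectors-than-coordinates n (Natₚ.m≤n⇒m≤1+n n<m) (λ i → M i ∘ suc)
    w = proj₁ ih
    nz = proj₁ (proj₂ ih)
    rel = proj₂ (proj₂ ih)
    zeroColumn : ∀ i → M i zero ≡ + 0
    zeroColumn i = decidable-stable (M i zero Int.≟ + 0) (λ ≢0 → none (i , ≢0))
    first : sum (λ i → w i * M i zero) ≡ + 0
    first = trans (sum-cong-≗ (λ i → trans (cong (w i *_) (zeroColumn i)) (Intₚ.*-zeroʳ (w i))))
                  (sum-replicate-zero (suc m))
  ... | yes (p , Mp≢0) = w , (punchIn p i₀ , w≢0) , rel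
    where
    pivot = M p zero
    row : Fin m → Vec' (suc n)
    row i = M (punchIn p i)
    reduced : Fin m → Vec' (suc n)
    reduced i c = pivot * row i c - row i zero * M p c
    ih = more-vectors-than-coordinates n n<m (λ i → reduced i ∘ suc)
    w′ = proj₁ ih
    i₀ = proj₁ (proj₁ (proj₂ ih))
    -- Scaling `w′` by `pivot` avoids division, and the weight at `p` is what makes this combination
    -- of the original vectors equal the `w′`-combination of the reduced ones.
    w : Vec' (suc m)
    w = insertAt (λ i → pivot * w′ i) p (- sum (λ i → w′ i * row i zero))
    w≢0 : w (punchIn p i₀) ≢ + 0
    w≢0 eq with Intₚ.i*j≡0⇒i≡0∨j≡0 pivot (trans (sym (insertAt-punchIn _ p _ i₀)) eq)
    ... | inj₁ z = Mp≢0 z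
    ... | inj₂ z = proj₂ (proj₁ (proj₂ ih)) z
    reduced-rel : ∀ c → sum (λ i → w′ i * reduced i c) ≡ + 0
    -- The elimination makes the first coordinate vanish whatever `w′` is; the induction hypothesis
    -- covers only the remaining ones.
    reduced-rel zero = trans (sum-cong-≗ (λ i → vanish (w′ i) pivot (row i zero)))
                             (sum-replicate-zero m)
      where
      vanish : ∀ x a b → x * (a * b - b * a) ≡ + 0
      vanish = solve-∀
    reduced-rel (suc c) = proj₂ (proj₂ ih) c
    rel : ∀ c → sum (λ i → w i * M i c) ≡ + 0
    rel c = begin
      sum (λ i → w i * M i c)
        ≡⟨ sum-remove {i = p} (λ i → w i * M i c) ⟩
      w p * M p c + sum (λ i → w (punchIn p i) * row i c)
        ≡⟨ cong₂ _+_ (cong (_* M p c) (insertAt-lookup _ p _))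
             (sum-cong-≗ (λ i → cong (_* row i c) (insertAt-punchIn _ p _ i))) ⟩
      - sum (λ i → w′ i * row i zero) * M p c + sum (λ i → pivot * w′ i * row i c)
        ≡⟨ reorder (sum (λ i → w′ i * row i zero)) (M p c) _ ⟩
      sum (λ i → pivot * w′ i * row i c) - sum (λ i → w′ i * row i zero) * M p c
        ≡⟨ cong (λ s → sum (λ i → pivot * w′ i * row i c) - s) (sym (∑-*ʳ (λ i → w′ i * row i zero) (M p c))) ⟩
      sum (λ i → pivot * w′ i * row i c) - sum (λ i → w′ i * row i zero * M p c)
        ≡⟨ sym (∑-sub (λ i → pivot * w′ i * row i c) (λ i → w′ i * row i zero * M p c)) ⟩
      sum (λ i → pivot * w′ i * row i c - w′ i * row i zero * M p c)
        ≡⟨ sum-cong-≗ (λ i → factor pivot (w′ i) (row i c) (row i zero) (M p c)) ⟩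
      sum (λ i → w′ i * reduced i c)
        ≡⟨ reduced-rel c ⟩
      + 0 ∎
      where
      reorder : ∀ s x t → - s * x + t ≡ t - s * x
      reorder = solve-∀
      factor : ∀ q x a b d → q * x * a - x * b * d ≡ x * (q * a - b * d)
      factor = solve-∀

-- Families of 2k-sets with pairwise intersections of size k.

-- m indicator vectors of 2k-subsets of Fin n, any two of which meet in k points.
record Equiintersecting (m n k : ℕ) (y : Fin m → Vec' n) : Set where
  field
    binary : ∀ i c → y i c ≡ + 0 ⊎ y i c ≡ + 1
    -- A single formula covers the diagonal value 2k and the off-diagonal value k, so Gram sums can
    -- be evaluated by `∑-ε` without splitting on i = j.
    gram   : ∀ i j → sum (λ c → y i c Int.* y j c) ≡ + k Int.* (+ 1 Int.+ ε i j)

module EquiintersectingProperties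
  {m n k : ℕ} {y : Fin m → Vec' n} (E : Equiintersecting m n k y) where

  open Int using (_≤_; _+_; _*_; _-_; -_)
  open Inequalities
  open Sums
  open Equiintersecting E
  open ≡-Reasoning

  idem : ∀ i c → y i c * y i c ≡ y i c
  idem i c with y i c | binary i c
  ... | _ | inj₁ refl = refl
  ... | _ | inj₂ refl = refl

  0≤y : ∀ i c → + 0 ≤ y i c
  0≤y i c = subst (+ 0 ≤_) (idem i c) (0≤sq (y i c))

  y≤1 : ∀ i c → y i c ≤ + 1
  y≤1 i c with y i c | binary i c
  ... | _ | inj₁ refl = Int.+≤+ Nat.z≤n
  ... | _ | inj₂ refl = Intₚ.≤-refl

  size : ∀ i → sum (y i) ≡ + k * + 2
  size i = begin
    sum (y i)                   ≡⟨ sum-cong-≗ (λ c → sym (idem i c)) ⟩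
    sum (λ c → y i c * y i c)   ≡⟨ gram i i ⟩
    + k * (+ 1 + ε i i)         ≡⟨ cong (λ e → + k * (+ 1 + e)) (ε-diag i) ⟩
    + k * + 2                   ∎

  meet : ∀ {i j} → i ≢ j → sum (λ c → y i c * y j c) ≡ + k
  meet {i} {j} i≢j = begin
    sum (λ c → y i c * y j c)   ≡⟨ gram i j ⟩
    + k * (+ 1 + ε i j)         ≡⟨ cong (λ e → + k * (+ 1 + e)) (ε-off (i≢j ∘ sym)) ⟩
    + k * + 1                   ≡⟨ Intₚ.*-identityʳ (+ k) ⟩
    + k                         ∎

  combination : Vec' m → Vec' n
  combination w c = sum (λ j → w j * y j c)

  -- The Gram matrix is k (I + J) with J the all-ones matrix; this is row i of it applied to `w`.
  ⟨y,combination⟩ : ∀ w i → sum (λ c → y i c * combination w c) ≡ + k * (w i + sum w)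
  ⟨y,combination⟩ w i = begin
    sum (λ c → y i c * combination w c)
      ≡⟨ ∑-swap-* (y i) (λ j c → w j * y j c) ⟩
    sum (λ j → sum (λ c → y i c * (w j * y j c)))
      ≡⟨ sum-cong-≗ inner ⟩
    sum (λ j → + k * (w j * ε i j + w j))
      ≡⟨ ∑-*ˡ (+ k) (λ j → w j * ε i j + w j) ⟩
    + k * sum (λ j → w j * ε i j + w j)
      ≡⟨ cong (+ k *_) (trans (∑-distrib-+ (λ j → w j * ε i j) w) (cong (_+ sum w) (∑-ε w i))) ⟩
    + k * (w i + sum w) ∎
    where
    reorder : ∀ a b c → a * (b * c) ≡ b * (a * c)
    reorder = solve-∀
    expand : ∀ w k e → w * (k * (+ 1 + e)) ≡ k * (w * e + w)
    expand = solve-∀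
    inner : ∀ j → sum (λ c → y i c * (w j * y j c)) ≡ + k * (w j * ε i j + w j)
    inner j = begin
      sum (λ c → y i c * (w j * y j c))    ≡⟨ sum-cong-≗ (λ c → reorder (y i c) (w j) (y j c)) ⟩
      sum (λ c → w j * (y i c * y j c))    ≡⟨ ∑-*ˡ (w j) (λ c → y i c * y j c) ⟩
      w j * sum (λ c → y i c * y j c)      ≡⟨ cong (w j *_) (gram i j) ⟩
      w j * (+ k * (+ 1 + ε i j))          ≡⟨ expand (w j) (+ k) (ε i j) ⟩
      + k * (w j * ε i j + w j)            ∎

  norm-combination : ∀ w → sum (λ c → combination w c * combination w c)
                           ≡ + k * (sum (λ i → w i * w i) + sum w * sum w)
  norm-combination w = begin
    sum (λ c → combination w c * combination w c)
      ≡⟨ ∑-swap-* (combination w) (λ i c → w i * y i c) ⟩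
    sum (λ i → sum (λ c → combination w c * (w i * y i c)))
      ≡⟨ sum-cong-≗ inner ⟩
    sum (λ i → + k * (w i * w i + w i * sum w))
      ≡⟨ ∑-*ˡ (+ k) (λ i → w i * w i + w i * sum w) ⟩
    + k * sum (λ i → w i * w i + w i * sum w)
      ≡⟨ cong (+ k *_) (trans (∑-distrib-+ (λ i → w i * w i) (λ i → w i * sum w))
           (cong (λ s → sum (λ i → w i * w i) + s) (∑-*ʳ w (sum w)))) ⟩
    + k * (sum (λ i → w i * w i) + sum w * sum w) ∎
    where
    reorder : ∀ a b c → a * (b * c) ≡ b * (c * a)
    reorder = solve-∀
    expand : ∀ w k s → w * (k * (w + s)) ≡ k * (w * w + w * s)
    expand = solve-∀
    inner : ∀ i → sum (λ c → combination w c * (w i * y i c)) ≡ + k * (w i * w i + w i * sum w)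
    inner i = begin
      sum (λ c → combination w c * (w i * y i c))
        ≡⟨ sum-cong-≗ (λ c → reorder (combination w c) (w i) (y i c)) ⟩
      sum (λ c → w i * (y i c * combination w c))
        ≡⟨ ∑-*ˡ (w i) (λ c → y i c * combination w c) ⟩
      w i * sum (λ c → y i c * combination w c)
        ≡⟨ cong (w i *_) (⟨y,combination⟩ w i) ⟩
      w i * (+ k * (w i + sum w))
        ≡⟨ expand (w i) (+ k) (sum w) ⟩
      + k * (w i * w i + w i * sum w) ∎

  -- A vanishing combination has norm 0. Cancelling k leaves Σ w² + (Σ w)² = 0, so Σ w² ≤ 0 and
  -- every weight is 0.
  linearly-independent : .{{_ : NonZero k}} → ¬ LinearlyDependent y
  linearly-independent (w , (i , wi≢0) , rel) = wi≢0 (sq≡0⇒≡0 (w i) (∑-nonneg-≤0 (λ j → 0≤sq (w j)) ∑w²≤0 i))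
    where
    form≡0 : + k * (sum (λ i → w i * w i) + sum w * sum w) ≡ + 0
    form≡0 = trans (sym (norm-combination w))
      (trans (sum-cong-≗ (λ c → cong₂ _*_ (rel c) (rel c))) (sum-replicate-zero n))
    bracket≡0 : sum (λ i → w i * w i) + sum w * sum w ≡ + 0
    bracket≡0 = Intₚ.*-cancelˡ-≡ (+ k) _ (+ 0) (trans form≡0 (sym (Intₚ.*-zeroʳ (+ k))))
    shuffle : ∀ a b → b + (+ 0 - (a + b)) ≡ + 0 - a
    shuffle = solve-∀
    ∑w²≤0 : sum (λ i → w i * w i) ≤ + 0
    ∑w²≤0 = 0≤⇒≤ (subst (+ 0 ≤_) (shuffle (sum (λ i → w i * w i)) (sum w * sum w))
      (0≤+ (0≤sq (sum w)) (≤⇒0≤ (Intₚ.≤-reflexive bracket≡0))))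

  members≤points : .{{_ : NonZero k}} → m Nat.≤ n
  members≤points with m Nat.≤? n
  ... | yes p = p
  ... | no p  = ⊥-elim (linearly-independent (more-vectors-than-coordinates n (Natₚ.≰⇒> p) y))

  degree : Vec' n
  degree c = sum (λ i → y i c)

  0≤degree : ∀ c → + 0 ≤ degree c
  0≤degree c = ∑-nonneg (λ i → 0≤y i c)

  degree≤m : ∀ c → degree c ≤ + m
  degree≤m c = subst (degree c ≤_) (trans (∑-const m (+ 1)) (Intₚ.*-identityʳ (+ m)))
    (∑-mono (λ i → y≤1 i c))

  -- The degree vector is the combination with all weights 1.
  ⟨y,degree⟩ : ∀ i → sum (λ c → y i c * degree c) ≡ + k * (+ 1 + + m)
  ⟨y,degree⟩ i = begin
    sum (λ c → y i c * degree c)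
      ≡⟨ sum-cong-≗ (λ c → cong (y i c *_) (sum-cong-≗ (λ j → sym (Intₚ.*-identityˡ (y j c))))) ⟩
    sum (λ c → y i c * combination (const (+ 1)) c)
      ≡⟨ ⟨y,combination⟩ (const (+ 1)) i ⟩
    + k * (+ 1 + sum {m} (const (+ 1)))
      ≡⟨ cong (λ s → + k * (+ 1 + s)) (trans (∑-const m (+ 1)) (Intₚ.*-identityʳ (+ m))) ⟩
    + k * (+ 1 + + m) ∎

  -- Test the Gram form on the weights m - a on the members through c and - a on
  -- the others (a the degree of c): they sum to 0, and the combination takes the
  -- value (m - a) a at c.
  degree-product : ∀ c → (+ m - degree c) * degree c ≤ + k * + m
  degree-product c with (+ m - degree c) * degree c Int.≤? + k * + m
  ... | yes p = p
  -- The norm of the combination is k m q, and its coordinate c alone contributes q². Failure of the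
  -- bound makes q positive, so one factor q cancels.
  ... | no p  = Intₚ.*-cancelʳ-≤-pos q (+ k * + m) q {{Int.positive q>0}} q²≤kmq
    where
    a q : ℤ
    a = degree c
    q = (+ m - a) * a
    w : Vec' m
    w i = + m * y i c - a
    q>0 : + 0 Int.< q
    q>0 = Intₚ.≤-<-trans (0≤* {+ k} {+ m} (Int.+≤+ Nat.z≤n) (Int.+≤+ Nat.z≤n)) (Intₚ.≰⇒> p)
    ∑w : sum w ≡ + 0
    ∑w = begin
      sum w
        ≡⟨ ∑-sub (λ i → + m * y i c) (const a) ⟩
      sum (λ i → + m * y i c) - sum {m} (const a)
        ≡⟨ cong₂ _-_ (∑-*ˡ (+ m) (λ i → y i c)) (∑-const m a) ⟩
      + m * a - + m * a
        ≡⟨ Intₚ.+-inverseʳ (+ m * a) ⟩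
      + 0 ∎
    value : combination w c ≡ q
    value = begin
      combination w c
        ≡⟨ sum-cong-≗ (λ i → trans (expand (+ m) (y i c) a)
             (trans (cong (λ z → + m * z - a * y i c) (idem i c)) (contract (+ m) (y i c) a))) ⟩
      sum (λ i → (+ m - a) * y i c)
        ≡⟨ ∑-*ˡ (+ m - a) (λ i → y i c) ⟩
      q ∎
      where
      expand : ∀ m y a → (m * y - a) * y ≡ m * (y * y) - a * y
      expand = solve-∀
      contract : ∀ m y a → m * y - a * y ≡ (m - a) * y
      contract = solve-∀
    ∑w² : sum (λ i → w i * w i) ≡ + m * q
    ∑w² = begin
      sum (λ i → w i * w i)
        ≡⟨ sum-cong-≗ (λ i → trans (expand (+ m) (y i c) a)
             (trans (cong (λ z → + m * + m * z - + 2 * + m * a * y i c + a * a) (idem i c))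
               (contract (+ m) (y i c) a))) ⟩
      sum (λ i → (+ m * + m - + 2 * + m * a) * y i c + a * a)
        ≡⟨ ∑-distrib-+ (λ i → (+ m * + m - + 2 * + m * a) * y i c) (const (a * a)) ⟩
      sum (λ i → (+ m * + m - + 2 * + m * a) * y i c) + sum {m} (const (a * a))
        ≡⟨ cong₂ _+_ (∑-*ˡ (+ m * + m - + 2 * + m * a) (λ i → y i c)) (∑-const m (a * a)) ⟩
      (+ m * + m - + 2 * + m * a) * a + + m * (a * a)
        ≡⟨ collect (+ m) a ⟩
      + m * q ∎
      where
      expand : ∀ m y a → (m * y - a) * (m * y - a) ≡ m * m * (y * y) - + 2 * m * a * y + a * a
      expand = solve-∀
      contract : ∀ m y a → m * m * y - + 2 * m * a * y + a * a ≡ (m * m - + 2 * m * a) * y + a * a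
      contract = solve-∀
      collect : ∀ m a → (m * m - + 2 * m * a) * a + m * (a * a) ≡ m * ((m - a) * a)
      collect = solve-∀
    q²≤kmq : q * q ≤ + k * + m * q
    q²≤kmq = subst₂ _≤_ (cong₂ _*_ value value) total (term≤∑ (λ c → 0≤sq (combination w c)) c)
      where
      total : sum (λ c → combination w c * combination w c) ≡ + k * + m * q
      total = begin
        sum (λ c → combination w c * combination w c)
          ≡⟨ norm-combination w ⟩
        + k * (sum (λ i → w i * w i) + sum w * sum w)
          ≡⟨ cong₂ (λ s t → + k * (s + t * t)) ∑w² ∑w ⟩
        + k * (+ m * q + + 0)
          ≡⟨ cong (+ k *_) (Intₚ.+-identityʳ (+ m * q)) ⟩
        + k * (+ m * q)
          ≡⟨ sym (Intₚ.*-assoc (+ k) (+ m) q) ⟩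
        + k * + m * q ∎

-- Kernel and petals of a family above the threshold.

module LargeEquiintersecting
  {m n k : ℕ} {y : Fin m → Vec' n} (E : Equiintersecting m n k y)
  (large : + 2 Int.+ + k Int.* (+ k Int.+ + 2) Int.≤ + m) where

  open Int using (_≤_; _+_; _*_; _-_; -_)
  open Inequalities
  open Sums
  open Equiintersecting E
  open EquiintersectingProperties E
  open ≡-Reasoning

  0≤k : + 0 ≤ + k
  0≤k = Int.+≤+ Nat.z≤n

  light-or-heavy : ∀ c → degree c ≤ + k ⊎ + m - + k ≤ degree c
  light-or-heavy c = no-medium (+ m) (degree c) (+ k) large (degree-product c)

  abstract
    -- A 0/1 vector, so that heavy points are counted by sums. It is opaque so that goals keep
    -- `heavy c` as a term, which a `with` can replace by its value together with
    -- `light-heavy-cases c`.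
    heavy : Vec' n
    heavy c = [ const (+ 0) , const (+ 1) ] (light-or-heavy c)

    light-heavy-cases : ∀ c → (heavy c ≡ + 0 × degree c ≤ + k) ⊎ (heavy c ≡ + 1 × + m - + k ≤ degree c)
    light-heavy-cases c with light-or-heavy c
    ... | inj₁ p = inj₁ (refl , p)
    ... | inj₂ p = inj₂ (refl , p)

  0≤heavy : ∀ c → + 0 ≤ heavy c
  0≤heavy c with heavy c | light-heavy-cases c
  ... | _ | inj₁ (refl , _) = Intₚ.≤-refl
  ... | _ | inj₂ (refl , _) = Int.+≤+ Nat.z≤n

  -- Together with `degree-upper` this puts light degrees in [0, k] and heavy degrees in [m - k, m].
  -- Both bounds are affine in `heavy`, ready to be summed against a member.
  degree-lower : ∀ c → (+ m - + k) * heavy c ≤ degree c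
  degree-lower c with heavy c | light-heavy-cases c
  ... | _ | inj₁ (refl , _) = subst (_≤ degree c) (sym (Intₚ.*-zeroʳ (+ m - + k))) (0≤degree c)
  ... | _ | inj₂ (refl , p) = subst (_≤ degree c) (sym (Intₚ.*-identityʳ (+ m - + k))) p

  degree-upper : ∀ c → degree c ≤ + k + (+ m - + k) * heavy c
  degree-upper c with heavy c | light-heavy-cases c
  ... | _ | inj₁ (refl , p) = subst (degree c ≤_) (light-value (+ m) (+ k)) p
    where
    light-value : ∀ m k → k ≡ k + (m - k) * + 0
    light-value = solve-∀
  ... | _ | inj₂ (refl , _) = subst (degree c ≤_) (heavy-value (+ m) (+ k)) (degree≤m c)
    where
    heavy-value : ∀ m k → m ≡ k + (m - k) * + 1
    heavy-value = solve-∀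

  *-mono-y : ∀ i c {a b} → a ≤ b → y i c * a ≤ y i c * b
  *-mono-y i c a≤b = Intₚ.*-monoˡ-≤-nonNeg (y i c) {{Int.nonNegative (0≤y i c)}} a≤b

  heavyPoints : Fin m → ℤ
  heavyPoints i = sum (λ c → y i c * heavy c)

  heavyPoints-factor : ∀ i x → sum (λ c → y i c * (x * heavy c)) ≡ x * heavyPoints i
  heavyPoints-factor i x = trans (sum-cong-≗ (λ c → reorder (y i c) x (heavy c)))
                                 (∑-*ˡ x (λ c → y i c * heavy c))
    where
    reorder : ∀ a b c → a * (b * c) ≡ b * (a * c)
    reorder = solve-∀

  -- Let t be the number of heavy points of member i. Pairing the two degree bounds with `y i` gives
  -- (m - k) t ≤ k (1 + m) ≤ 2k² + (m - k) t, and the two counting inequalities force t = k.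
  heavyPoints≡k : ∀ i → heavyPoints i ≡ + k
  heavyPoints≡k i = Intₚ.≤-antisym
    (heavy-count-≤ (+ m) (+ k) (heavyPoints i) 0≤k large
      (subst₂ _≤_ (heavyPoints-factor i (+ m - + k)) (⟨y,degree⟩ i)
        (∑-mono (λ c → *-mono-y i c (degree-lower c)))))
    (heavy-count-≥ (+ m) (+ k) (heavyPoints i) 0≤k large
      (subst₂ _≤_ (⟨y,degree⟩ i) split (∑-mono (λ c → *-mono-y i c (degree-upper c)))))
    where
    twice : ∀ k → (k * + 2) * k ≡ k * (+ 2 * k)
    twice = solve-∀
    split : sum (λ c → y i c * (+ k + (+ m - + k) * heavy c)) ≡ + k * (+ 2 * + k) + (+ m - + k) * heavyPoints i
    split = begin
      sum (λ c → y i c * (+ k + (+ m - + k) * heavy c))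
        ≡⟨ sum-cong-≗ (λ c → Intₚ.*-distribˡ-+ (y i c) (+ k) ((+ m - + k) * heavy c)) ⟩
      sum (λ c → y i c * + k + y i c * ((+ m - + k) * heavy c))
        ≡⟨ ∑-distrib-+ (λ c → y i c * + k) (λ c → y i c * ((+ m - + k) * heavy c)) ⟩
      sum (λ c → y i c * + k) + sum (λ c → y i c * ((+ m - + k) * heavy c))
        ≡⟨ cong₂ _+_ (trans (∑-*ʳ (y i) (+ k)) (trans (cong (_* + k) (size i)) (twice (+ k))))
             (heavyPoints-factor i (+ m - + k)) ⟩
      + k * (+ 2 * + k) + (+ m - + k) * heavyPoints i ∎

  y*heavy≤heavy : ∀ i c → y i c * heavy c ≤ heavy c
  y*heavy≤heavy i c = subst (y i c * heavy c ≤_) (Intₚ.*-identityˡ (heavy c))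
    (Intₚ.*-monoʳ-≤-nonNeg (heavy c) {{Int.nonNegative (0≤heavy c)}} (y≤1 i c))

  -- Incidences between heavy points and members number m k by `heavyPoints≡k`, while each heavy
  -- point accounts for at least m - k of them. Since m k ≤ k (1 + m), `heavy-count-≤` applies
  -- again.
  ∑heavy≤k : sum heavy ≤ + k
  ∑heavy≤k = heavy-count-≤ (+ m) (+ k) (sum heavy) 0≤k large
    (Intₚ.≤-trans (subst₂ _≤_ lhs rhs (∑-mono bound)) slack)
    where
    heavy²≡heavy : ∀ c → heavy c * heavy c ≡ heavy c
    heavy²≡heavy c with heavy c | light-heavy-cases c
    ... | _ | inj₁ (refl , _) = refl
    ... | _ | inj₂ (refl , _) = refl
    bound : ∀ c → (+ m - + k) * heavy c ≤ heavy c * degree c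
    bound c = subst₂ _≤_
      (trans (Intₚ.*-assoc (+ m - + k) (heavy c) (heavy c)) (cong ((+ m - + k) *_) (heavy²≡heavy c)))
      (Intₚ.*-comm (degree c) (heavy c))
      (Intₚ.*-monoʳ-≤-nonNeg (heavy c) {{Int.nonNegative (0≤heavy c)}} (degree-lower c))
    lhs : sum (λ c → (+ m - + k) * heavy c) ≡ (+ m - + k) * sum heavy
    lhs = ∑-*ˡ (+ m - + k) heavy
    rhs : sum (λ c → heavy c * degree c) ≡ + m * + k
    rhs = begin
      sum (λ c → heavy c * degree c)
        ≡⟨ ∑-swap-* heavy y ⟩
      sum (λ i → sum (λ c → heavy c * y i c))
        ≡⟨ sum-cong-≗ (λ i → trans (sum-cong-≗ (λ c → Intₚ.*-comm (heavy c) (y i c))) (heavyPoints≡k i)) ⟩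
      sum {m} (const (+ k))
        ≡⟨ ∑-const m (+ k) ⟩
      + m * + k ∎
    slack : + m * + k ≤ + k * (+ 1 + + m)
    slack = 0≤⇒≤ (subst (+ 0 ≤_) (difference (+ m) (+ k)) 0≤k)
      where
      difference : ∀ m k → k ≡ k * (+ 1 + m) - m * k
      difference = solve-∀

  -- Member i already contains k heavy points and there are at most k in all, so the nonnegative
  -- differences have total at most 0.
  heavy⇒member : ∀ i c → heavy c - y i c * heavy c ≡ + 0
  heavy⇒member i = ∑-nonneg-≤0 (λ c → ≤⇒0≤ (y*heavy≤heavy i c))
    (subst (_≤ + 0) (sym (∑-sub heavy (λ c → y i c * heavy c)))
      (Intₚ.i≤j⇒i-j≤0 (subst (sum heavy ≤_) (sym (heavyPoints≡k i)) ∑heavy≤k)))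

  heavy≤intersection : ∀ i j c → heavy c ≤ y i c * y j c
  heavy≤intersection i j c with heavy c | light-heavy-cases c | heavy⇒member i c | heavy⇒member j c
  ... | _ | inj₁ (refl , _) | _ | _ = 0≤* (0≤y i c) (0≤y j c)
  ... | _ | inj₂ (refl , _) | p | q =
    Intₚ.≤-reflexive (cong₂ _*_ (one (y i c) p) (one (y j c) q))
    where
    one : ∀ z → + 1 - z * + 1 ≡ + 0 → + 1 ≡ z
    one z eq = trans (Intₚ.i-j≡0⇒i≡j (+ 1) (z * + 1) eq) (Intₚ.*-identityʳ z)

  k≤∑heavy : Fin m → + k ≤ sum heavy
  k≤∑heavy i = subst (_≤ sum heavy) (heavyPoints≡k i) (∑-mono (y*heavy≤heavy i))

  -- The heavy points lie in the intersection, which has only k elements, and there are at least k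
  -- of them; comparing totals leaves no room for another point.
  intersection≡heavy : ∀ {i j} → i ≢ j → ∀ c → y i c * y j c ≡ heavy c
  intersection≡heavy {i} {j} i≢j c = Intₚ.i-j≡0⇒i≡j (y i c * y j c) (heavy c)
    (∑-nonneg-≤0 (λ c → ≤⇒0≤ (heavy≤intersection i j c))
      (subst (_≤ + 0) (sym (∑-sub (λ c → y i c * y j c) heavy))
        (Intₚ.i≤j⇒i-j≤0 (subst (_≤ sum heavy) (sym (meet i≢j)) (k≤∑heavy i)))) c)

  -- Distinct members meet only in heavy points. At a light point the square of the degree, which
  -- counts ordered pairs of members through c, therefore reduces to its diagonal part, the degree
  -- itself; an idempotent integer is at most 1.
  degree≤1+ : ∀ c → degree c ≤ + 1 + (+ m - + 1) * heavy c
  degree≤1+ c with light-heavy-cases c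
  ... | inj₂ (h≡1 , _) =
    subst (degree c ≤_) (trans (value (+ m)) (cong (λ h → + 1 + (+ m - + 1) * h) (sym h≡1))) (degree≤m c)
    where
    value : ∀ m → m ≡ + 1 + (m - + 1) * + 1
    value = solve-∀
  ... | inj₁ (h≡0 , _) =
    subst (degree c ≤_) (trans (value (+ m)) (cong (λ h → + 1 + (+ m - + 1) * h) (sym h≡0)))
      (idem⇒≤1 (degree c) degree-idem)
    where
    value : ∀ m → + 1 ≡ + 1 + (m - + 1) * + 0
    value = solve-∀
    idem⇒≤1 : ∀ a → a * a ≡ a → a ≤ + 1
    idem⇒≤1 a eq with Intₚ.i*j≡0⇒i≡0∨j≡0 a (trans (factor a) (Intₚ.i≡j⇒i-j≡0 eq))
      where
      factor : ∀ a → a * (a - + 1) ≡ a * a - a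
      factor = solve-∀
    ... | inj₁ p = Intₚ.≤-trans (Intₚ.≤-reflexive p) (Int.+≤+ Nat.z≤n)
    ... | inj₂ p = Intₚ.≤-reflexive (Intₚ.i-j≡0⇒i≡j a (+ 1) p)
    product : ∀ i j → y i c * y j c ≡ y j c * ε i j
    product i j with i ≟ j
    ... | yes refl = trans (idem i c) (sym (trans (cong (y i c *_) (ε-diag i)) (Intₚ.*-identityʳ (y i c))))
    ... | no i≢j   = trans (trans (intersection≡heavy i≢j c) h≡0)
                       (sym (trans (cong (y j c *_) (ε-off (i≢j ∘ sym))) (Intₚ.*-zeroʳ (y j c))))
    degree-idem : degree c * degree c ≡ degree c
    degree-idem = begin
      degree c * degree c                              ≡⟨ sym (∑-*ʳ (λ i → y i c) (degree c)) ⟩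
      sum (λ i → y i c * degree c)                     ≡⟨ sum-cong-≗ (λ i → sym (∑-*ˡ (y i c) (λ j → y j c))) ⟩
      sum (λ i → sum (λ j → y i c * y j c))            ≡⟨ sum-cong-≗ (λ i → sum-cong-≗ (product i)) ⟩
      sum (λ i → sum (λ j → y j c * ε i j))            ≡⟨ sum-cong-≗ (λ i → ∑-ε (λ j → y j c) i) ⟩
      degree c                                         ∎

  -- Counting all incidences in two ways gives 2 k m ≤ n + (m - 1) Σ heavy ≤ n + (m - 1) k.
  kernel-and-petals-fit : (+ m + + 1) * + k ≤ + n
  kernel-and-petals-fit =
    0≤⇒≤ (subst (+ 0 ≤_) (rearrange (+ m) (+ k) (+ n) (sum heavy))
      (0≤+ (≤⇒0≤ (subst₂ _≤_ lhs rhs (∑-mono degree≤1+))) (0≤* 0≤m-1 (≤⇒0≤ ∑heavy≤k))))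
    where
    lhs : sum degree ≡ + m * (+ k * + 2)
    lhs = begin
      sum degree                       ≡⟨ ∑-comm (λ c i → y i c) ⟩
      sum (λ i → sum (y i))            ≡⟨ sum-cong-≗ size ⟩
      sum {m} (const (+ k * + 2))      ≡⟨ ∑-const m (+ k * + 2) ⟩
      + m * (+ k * + 2)                ∎
    rhs : sum (λ c → + 1 + (+ m - + 1) * heavy c) ≡ + n + (+ m - + 1) * sum heavy
    rhs = begin
      sum (λ c → + 1 + (+ m - + 1) * heavy c)
        ≡⟨ ∑-distrib-+ (const (+ 1)) (λ c → (+ m - + 1) * heavy c) ⟩
      sum {n} (const (+ 1)) + sum (λ c → (+ m - + 1) * heavy c)
        ≡⟨ cong₂ _+_ (trans (∑-const n (+ 1)) (Intₚ.*-identityʳ (+ n))) (∑-*ˡ (+ m - + 1) heavy) ⟩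
      + n + (+ m - + 1) * sum heavy ∎
    0≤m-1 : + 0 ≤ + m - + 1
    0≤m-1 = subst (+ 0 ≤_) (certificate (+ m) (+ k))
      (0≤+ (≤⇒0≤ large) (0≤+ (0≤* 0≤k (0≤+ 0≤k (Int.+≤+ (Nat.z≤n {2})))) (Int.+≤+ (Nat.z≤n {1}))))
      where
      certificate : ∀ m k → (m - (+ 2 + k * (k + + 2))) + (k * (k + + 2) + + 1) ≡ m - + 1
      certificate = solve-∀
    rearrange : ∀ m k n h → (n + (m - + 1) * h - m * (k * + 2)) + (m - + 1) * (k - h) ≡ n - (m + + 1) * k
    rearrange = solve-∀

-- Coordinates, norms and supports of sums of strongly orthogonal roots.

module RootSums where

  open Int using (_≤_; _+_; _*_; _-_; -_; -[1+_])
  open Sums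
  open ≡-Reasoning

  Ternary : ℤ → Set
  Ternary x = x ≡ + 0 ⊎ x ≡ + 1 ⊎ x ≡ -[1+ 0 ]

  ternary-+ : ∀ {x y} → Ternary x → Ternary y → x * y ≡ + 0 → Ternary (x + y)
  ternary-+ (inj₁ refl)        (inj₁ refl)        _ = inj₁ refl
  ternary-+ (inj₁ refl)        (inj₂ (inj₁ refl)) _ = inj₂ (inj₁ refl)
  ternary-+ (inj₁ refl)        (inj₂ (inj₂ refl)) _ = inj₂ (inj₂ refl)
  ternary-+ (inj₂ (inj₁ refl)) (inj₁ refl)        _ = inj₂ (inj₁ refl)
  ternary-+ (inj₂ (inj₂ refl)) (inj₁ refl)        _ = inj₂ (inj₂ refl)
  ternary-+ (inj₂ (inj₁ refl)) (inj₂ (inj₁ refl)) ()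
  ternary-+ (inj₂ (inj₁ refl)) (inj₂ (inj₂ refl)) ()
  ternary-+ (inj₂ (inj₂ refl)) (inj₂ (inj₁ refl)) ()
  ternary-+ (inj₂ (inj₂ refl)) (inj₂ (inj₂ refl)) ()

  ternary-square : ∀ {x} → Ternary x → x * x ≡ + 0 ⊎ x * x ≡ + 1
  ternary-square (inj₁ refl)        = inj₁ refl
  ternary-square (inj₂ (inj₁ refl)) = inj₂ refl
  ternary-square (inj₂ (inj₂ refl)) = inj₂ refl

  -- A ternary difference excludes opposite signs, so x y ∈ {0, 1}.
  ternary-product : ∀ {x y} → Ternary x → Ternary y → Ternary (x - y) →
                    (x * x) * (y * y) ≡ x * y
  ternary-product (inj₁ refl)        (inj₁ refl)        _ = refl
  ternary-product (inj₁ refl)        (inj₂ (inj₁ refl)) _ = refl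
  ternary-product (inj₁ refl)        (inj₂ (inj₂ refl)) _ = refl
  ternary-product (inj₂ (inj₁ refl)) (inj₁ refl)        _ = refl
  ternary-product (inj₂ (inj₂ refl)) (inj₁ refl)        _ = refl
  ternary-product (inj₂ (inj₁ refl)) (inj₂ (inj₁ refl)) _ = refl
  ternary-product (inj₂ (inj₂ refl)) (inj₂ (inj₂ refl)) _ = refl
  ternary-product (inj₂ (inj₁ refl)) (inj₂ (inj₂ refl)) (inj₁ ())
  ternary-product (inj₂ (inj₁ refl)) (inj₂ (inj₂ refl)) (inj₂ (inj₁ ()))
  ternary-product (inj₂ (inj₁ refl)) (inj₂ (inj₂ refl)) (inj₂ (inj₂ ()))
  ternary-product (inj₂ (inj₂ refl)) (inj₂ (inj₁ refl)) (inj₁ ())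
  ternary-product (inj₂ (inj₂ refl)) (inj₂ (inj₁ refl)) (inj₂ (inj₁ ()))
  ternary-product (inj₂ (inj₂ refl)) (inj₂ (inj₁ refl)) (inj₂ (inj₂ ()))

  ε-cases : ∀ {n} (i c : Fin n) → ε i c ≡ + 0 ⊎ ε i c ≡ + 1
  ε-cases i c with c ≟ i
  ... | yes _ = inj₂ refl
  ... | no _  = inj₁ refl

  ε-idem : ∀ {n} (i c : Fin n) → ε i c * ε i c ≡ ε i c
  ε-idem i c with c ≟ i
  ... | yes _ = refl
  ... | no _  = refl

  ε-orthogonal : ∀ {n} {i j : Fin n} → i ≢ j → ∀ c → ε i c * ε j c ≡ + 0
  ε-orthogonal {i = i} {j} i≢j c with c ≟ i | c ≟ j
  ... | yes refl | yes refl = ⊥-elim (i≢j refl)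
  ... | yes _    | no _     = refl
  ... | no _     | yes _    = refl
  ... | no _     | no _     = refl

  ∑ε≡1 : ∀ {n} (i : Fin n) → sum (ε i) ≡ + 1
  ∑ε≡1 i = trans (sum-cong-≗ (λ c → sym (Intₚ.*-identityˡ (ε i c)))) (∑-ε (const (+ 1)) i)

  root-ternary : ∀ {n} (γ : Root n) c → Ternary (rootVec γ c)
  root-ternary (i , j) c with ε i c | ε-cases i c | ε j c | ε-cases j c
  ... | _ | inj₁ refl | _ | inj₁ refl = inj₁ refl
  ... | _ | inj₁ refl | _ | inj₂ refl = inj₂ (inj₂ refl)
  ... | _ | inj₂ refl | _ | inj₁ refl = inj₂ (inj₁ refl)
  ... | _ | inj₂ refl | _ | inj₂ refl = inj₁ refl

  root-norm : ∀ {n} (γ : Root n) → IsRoot γ → sum (λ c → rootVec γ c * rootVec γ c) ≡ + 2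
  root-norm (i , j) i≢j = begin
    sum (λ c → rootVec (i , j) c * rootVec (i , j) c)
      ≡⟨ sum-cong-≗ pointwise ⟩
    sum (λ c → ε i c + ε j c)
      ≡⟨ ∑-distrib-+ (ε i) (ε j) ⟩
    sum (ε i) + sum (ε j)
      ≡⟨ cong₂ _+_ (∑ε≡1 i) (∑ε≡1 j) ⟩
    + 2 ∎
    where
    expand : ∀ a b → (a - b) * (a - b) ≡ a * a + b * b - + 2 * (a * b)
    expand = solve-∀
    pointwise : ∀ c → rootVec (i , j) c * rootVec (i , j) c ≡ ε i c + ε j c
    pointwise c = begin
      rootVec (i , j) c * rootVec (i , j) c
        ≡⟨ expand (ε i c) (ε j c) ⟩
      ε i c * ε i c + ε j c * ε j c - + 2 * (ε i c * ε j c)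
        ≡⟨ cong₂ (λ s t → s - + 2 * t) (cong₂ _+_ (ε-idem i c) (ε-idem j c)) (ε-orthogonal i≢j c) ⟩
      ε i c + ε j c + + 0
        ≡⟨ Intₚ.+-identityʳ (ε i c + ε j c) ⟩
      ε i c + ε j c ∎

  -- The supports are disjoint, so the product vanishes at each coordinate and not just in total.
  -- This pointwise form yields both the ternary entries and the norm of a sum of such roots.
  roots-orthogonal : ∀ {n} (γ γ′ : Root n) → StronglyOrth γ γ′ → ∀ c → rootVec γ c * rootVec γ′ c ≡ + 0
  roots-orthogonal (i , j) (i′ , j′) (ii , ij , ji , jj) c =
    trans (expand (ε i c) (ε j c) (ε i′ c) (ε j′ c))
      (cong₂ _+_ (cong₂ _-_ (ε-orthogonal ii c) (ε-orthogonal ij c))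
                 (cong₂ _-_ (ε-orthogonal jj c) (ε-orthogonal ji c)))
    where
    expand : ∀ a b x y → (a - b) * (x - y) ≡ (a * x - a * y) + (b * y - b * x)
    expand = solve-∀

  root-orthogonal-sum : ∀ {n} (γ : Root n) {Γ} → All (StronglyOrth γ) Γ → ∀ c → rootVec γ c * ∣ Γ ∣ c ≡ + 0
  root-orthogonal-sum γ []                c = Intₚ.*-zeroʳ (rootVec γ c)
  root-orthogonal-sum γ {γ′ ∷ Γ} (o ∷ os) c =
    trans (Intₚ.*-distribˡ-+ (rootVec γ c) (rootVec γ′ c) (∣ Γ ∣ c))
      (cong₂ _+_ (roots-orthogonal γ γ′ o c) (root-orthogonal-sum γ os c))

  sum-ternary : ∀ {n} {Γ : List (Root n)} → AllPairs StronglyOrth Γ → ∀ c → Ternary (∣ Γ ∣ c)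
  sum-ternary []                 c = inj₁ refl
  sum-ternary {Γ = γ ∷ _} (o ∷ os) c =
    ternary-+ (root-ternary γ c) (sum-ternary os c) (root-orthogonal-sum γ o c)

  sum-norm : ∀ {n} {Γ : List (Root n)} → All IsRoot Γ → AllPairs StronglyOrth Γ →
             sum (λ c → ∣ Γ ∣ c * ∣ Γ ∣ c) ≡ + length Γ * + 2
  sum-norm {n} [] [] = sum-replicate-zero n
  sum-norm {n} {γ ∷ Γ} (r ∷ rs) (o ∷ os) = begin
    sum (λ c → ∣ γ ∷ Γ ∣ c * ∣ γ ∷ Γ ∣ c)
      ≡⟨ sum-cong-≗ pointwise ⟩
    sum (λ c → rootVec γ c * rootVec γ c + ∣ Γ ∣ c * ∣ Γ ∣ c)
      ≡⟨ ∑-distrib-+ (λ c → rootVec γ c * rootVec γ c) (λ c → ∣ Γ ∣ c * ∣ Γ ∣ c) ⟩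
    sum (λ c → rootVec γ c * rootVec γ c) + sum (λ c → ∣ Γ ∣ c * ∣ Γ ∣ c)
      ≡⟨ cong₂ _+_ (root-norm γ r) (sum-norm rs os) ⟩
    + 2 + + length Γ * + 2
      ≡⟨ sym (Intₚ.suc-* (+ length Γ) (+ 2)) ⟩
    + suc (length Γ) * + 2 ∎
    where
    expand : ∀ a b → (a + b) * (a + b) ≡ a * a + b * b + + 2 * (a * b)
    expand = solve-∀
    pointwise : ∀ c → ∣ γ ∷ Γ ∣ c * ∣ γ ∷ Γ ∣ c ≡ rootVec γ c * rootVec γ c + ∣ Γ ∣ c * ∣ Γ ∣ c
    pointwise c = trans (expand (rootVec γ c) (∣ Γ ∣ c))
      (trans (cong (λ z → rootVec γ c * rootVec γ c + ∣ Γ ∣ c * ∣ Γ ∣ c + + 2 * z) (root-orthogonal-sum γ o c))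
        (Intₚ.+-identityʳ (rootVec γ c * rootVec γ c + ∣ Γ ∣ c * ∣ Γ ∣ c)))

  support : ∀ {n} → List (Root n) → Vec' n
  support Γ c = ∣ Γ ∣ c * ∣ Γ ∣ c

  module _ {n k : ℕ} where

    SOS-ternary : ∀ {Γ} → SOS n k Γ → ∀ c → Ternary (∣ Γ ∣ c)
    SOS-ternary S = sum-ternary (SOS.sorth S)

    SOS-norm : ∀ {Γ} → SOS n k Γ → sum (support Γ) ≡ + k * + 2
    SOS-norm S = trans (sum-norm (SOS.roots S) (SOS.sorth S)) (cong (λ l → + l * + 2) (SOS.card S))

    support-product : ∀ {Γ Γ′} → SOS n k Γ → SOS n k Γ′ → DiffRep n k Γ Γ′ →
                      ∀ c → support Γ c * support Γ′ c ≡ ∣ Γ ∣ c * ∣ Γ′ ∣ c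
    support-product S S′ (_ , S″ , eq) c =
      ternary-product (SOS-ternary S c) (SOS-ternary S′ c) (subst Ternary (sym (eq c)) (SOS-ternary S″ c))

    -- Comparing |x - x′|² = 2k with |x|² + |x′|² - 2 ⟨x , x′⟩ = 4k - 2 ⟨x , x′⟩.
    support-meet : ∀ {Γ Γ′} → SOS n k Γ → SOS n k Γ′ → DiffRep n k Γ Γ′ →
                   sum (λ c → support Γ c * support Γ′ c) ≡ + k
    support-meet {Γ} {Γ′} S S′ D@(Γ″ , S″ , eq) = trans (sum-cong-≗ (support-product S S′ D))
      (Intₚ.*-cancelʳ-≡ p (+ k) (+ 2) (isolate p (+ k) identity))
      where
      p : ℤ
      p = sum (λ c → ∣ Γ ∣ c * ∣ Γ′ ∣ c)
      expand : ∀ x y → (x - y) * (x - y) ≡ x * x + y * y - x * y * + 2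
      expand = solve-∀
      identity : + k * + 2 ≡ + k * + 2 + + k * + 2 - p * + 2
      identity = begin
        + k * + 2
          ≡⟨ sym (SOS-norm S″) ⟩
        sum (support Γ″)
          ≡⟨ sum-cong-≗ (λ c → trans (sym (cong₂ _*_ (eq c) (eq c))) (expand (∣ Γ ∣ c) (∣ Γ′ ∣ c))) ⟩
        sum (λ c → support Γ c + support Γ′ c - ∣ Γ ∣ c * ∣ Γ′ ∣ c * + 2)
          ≡⟨ ∑-sub (λ c → support Γ c + support Γ′ c) (λ c → ∣ Γ ∣ c * ∣ Γ′ ∣ c * + 2) ⟩
        sum (λ c → support Γ c + support Γ′ c) - sum (λ c → ∣ Γ ∣ c * ∣ Γ′ ∣ c * + 2)
          ≡⟨ cong₂ _-_ (trans (∑-distrib-+ (support Γ) (support Γ′)) (cong₂ _+_ (SOS-norm S) (SOS-norm S′)))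
               (∑-*ʳ (λ c → ∣ Γ ∣ c * ∣ Γ′ ∣ c) (+ 2)) ⟩
        + k * + 2 + + k * + 2 - p * + 2 ∎
      isolate : ∀ p k → k * + 2 ≡ k * + 2 + k * + 2 - p * + 2 → p * + 2 ≡ k * + 2
      isolate p k eq = Intₚ.i-j≡0⇒i≡j (p * + 2) (k * + 2)
        (trans (shuffle p k) (Intₚ.i≡j⇒i-j≡0 eq))
        where
        shuffle : ∀ p k → p * + 2 - k * + 2 ≡ k * + 2 - (k * + 2 + k * + 2 - p * + 2)
        shuffle = solve-∀

-- From SOS-cliques to equiintersecting families.

AllPairs-lookup : ∀ {A : Set} {R : A → A → Set} → Symmetric R → ∀ {xs} → AllPairs R xs →
                  ∀ {i j} → i ≢ j → R (lookup xs i) (lookup xs j)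
AllPairs-lookup s (r ∷ rs) {zero}  {zero}  i≢j = ⊥-elim (i≢j refl)
AllPairs-lookup s (r ∷ rs) {zero}  {suc j} i≢j = All.lookup r (∈-lookup j)
AllPairs-lookup s (r ∷ rs) {suc i} {zero}  i≢j = s (All.lookup r (∈-lookup i))
AllPairs-lookup s (r ∷ rs) {suc i} {suc j} i≢j = AllPairs-lookup s rs (i≢j ∘ cong suc)

module CliqueProperties {n k : ℕ} {F : List (List (Root n))} (C : SOSClique n k F) where

  open Int using (_+_; _*_)
  open Sums
  open RootSums
  open SOSClique C

  supports : Fin (length F) → Vec' n
  supports i = support (lookup F i)

  member : ∀ i → SOS n k (lookup F i)
  member i = All.lookup members (∈-lookup i)

  equiintersecting : Equiintersecting (length F) n k supports
  equiintersecting = record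
    { binary = λ i c → ternary-square (SOS-ternary (member i) c)
    ; gram   = gram
    }
    where
    square-idem : ∀ {z} → z ≡ + 0 ⊎ z ≡ + 1 → z * z ≡ z
    square-idem (inj₁ refl) = refl
    square-idem (inj₂ refl) = refl
    gram : ∀ i j → sum (λ c → supports i c * supports j c) ≡ + k * (+ 1 + ε i j)
    gram i j with i ≟ j
    ... | yes refl = trans (sum-cong-≗ (λ c → square-idem (ternary-square (SOS-ternary (member i) c))))
                       (trans (SOS-norm (member i)) (cong (λ e → + k * (+ 1 + e)) (sym (ε-diag i))))
    ... | no i≢j   = trans (support-meet (member i) (member j) (proj₁ (AllPairs-lookup swap clique i≢j)))
                       (trans (sym (Intₚ.*-identityʳ (+ k)))
                         (cong (λ e → + k * (+ 1 + e)) (sym (ε-off (i≢j ∘ sym)))))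

  -- Translates S(Γ, Γ′) into the product of indicators, the quantity that `intersection≡heavy`
  -- determines.
  InS⇔product≢0 : ∀ a b c → InS (lookup F a) (lookup F b) c ⇔ (supports a c * supports b c ≢ + 0)
  InS⇔product≢0 a b c = mk⇔ to from
    where
    x z : ℤ
    x = ∣ lookup F a ∣ c
    z = ∣ lookup F b ∣ c
    to : x ≢ + 0 × z ≢ + 0 → (x * x) * (z * z) ≢ + 0
    to (x≢0 , z≢0) eq with Intₚ.i*j≡0⇒i≡0∨j≡0 (x * x) eq
    ... | inj₁ p = x≢0 (Inequalities.sq≡0⇒≡0 x p)
    ... | inj₂ p = z≢0 (Inequalities.sq≡0⇒≡0 z p)
    from : (x * x) * (z * z) ≢ + 0 → x ≢ + 0 × z ≢ + 0
    from ≢0 = (λ x≡0 → ≢0 (cong (λ t → (t * t) * (z * z)) x≡0))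
            , (λ z≡0 → ≢0 (trans (cong (λ t → (x * x) * (t * t)) z≡0) (Intₚ.*-zeroʳ (x * x))))

  length≤n : .{{_ : NonZero k}} → length F Nat.≤ n
  length≤n = EquiintersectingProperties.members≤points equiintersecting

  module _ (large : 2 Nat.+ k Nat.* (k Nat.+ 2) Nat.≤ length F) where

    open LargeEquiintersecting equiintersecting
      (subst (Int._≤ + length F) (cong (λ t → + 2 + t) (Intₚ.pos-* k (k Nat.+ 2))) (Int.+≤+ large))

    large⇒sunflower : Sunflower F
    large⇒sunflower a b a′ b′ a≢b a′≢b′ c = mk⇔
      (λ s → from (InS⇔product≢0 a′ b′ c) (subst (_≢ + 0) same (to (InS⇔product≢0 a b c) s)))
      (λ s → from (InS⇔product≢0 a b c) (subst (_≢ + 0) (sym same) (to (InS⇔product≢0 a′ b′ c) s)))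
      where
      open Equivalence
      same : supports a c * supports b c ≡ supports a′ c * supports b′ c
      same = trans (intersection≡heavy a≢b c) (sym (intersection≡heavy a′≢b′ c))

    large⇒fits : suc (length F) Nat.* k Nat.≤ n
    large⇒fits = Intₚ.drop‿+≤+ (subst (Int._≤ + n)
      (trans (cong (_* + k) (cong +_ (Natₚ.+-comm (length F) 1))) (sym (Intₚ.pos-* (suc (length F)) k)))
      kernel-and-petals-fit)

-- A sunflower clique attaining the bound.

-- Point t of the block p of k coordinates; the kernel is block zero.
module DisjointBlocks {n k q : ℕ} (fits : suc q Nat.* k Nat.≤ n) where

  open Int using (_+_; _-_)
  open ≡-Reasoning

  point : Fin (suc q) → Fin k → Fin n
  point p t = inject≤ (combine p t) fits

  point-injective : ∀ p t p′ t′ → point p t ≡ point p′ t′ → p ≡ p′ × t ≡ t′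
  point-injective p t p′ t′ eq =
    combine-injective p t p′ t′ (inject≤-injective fits fits (combine p t) (combine p′ t′) eq)

  edge : Fin (suc q) → Fin (suc q) → Fin k → Root n
  edge p p′ t = point p t , point p′ t

  matching : Fin (suc q) → Fin (suc q) → List (Root n)
  matching p p′ = tabulate (edge p p′)

  matching-SOS : ∀ {p p′} → p ≢ p′ → SOS n k (matching p p′)
  matching-SOS {p} {p′} p≢p′ = record
    { roots = Allₚ.tabulate⁺ (λ t → p≢p′ ∘ proj₁ ∘ point-injective p t p′ t)
    ; sorth = AllPairsₚ.tabulate⁺ (λ {t} {t′} t≢t′ →
        t≢t′ ∘ proj₂ ∘ point-injective p t p t′ ,
        p≢p′ ∘ proj₁ ∘ point-injective p t p′ t′ ,
        p≢p′ ∘ sym ∘ proj₁ ∘ point-injective p′ t p t′ ,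
        t≢t′ ∘ proj₂ ∘ point-injective p′ t p′ t′)
    ; card  = length-tabulate (edge p p′)
    }

  sum-difference : ∀ {l} (f g h : Fin l → Root n) c →
                   (∀ t → rootVec (f t) c - rootVec (g t) c ≡ rootVec (h t) c) →
                   ∣ tabulate f ∣ c - ∣ tabulate g ∣ c ≡ ∣ tabulate h ∣ c
  sum-difference {zero}  f g h c eq = refl
  sum-difference {suc l} f g h c eq =
    trans (interchange (rootVec (f zero) c) _ (rootVec (g zero) c) _)
      (cong₂ _+_ (eq zero) (sum-difference (f ∘ suc) (g ∘ suc) (h ∘ suc) c (eq ∘ suc)))
    where
    interchange : ∀ a b x y → (a + b) - (x + y) ≡ (a - x) + (b - y)
    interchange = solve-∀

  petal : Fin q → List (Root n)
  petal p = matching zero (suc p)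

  -- The kernel endpoints cancel edge by edge, leaving the matching from the block of `p′` to the
  -- block of `p`.
  petal-difference : ∀ {p p′} → p ≢ p′ → DiffRep n k (petal p) (petal p′)
  petal-difference {p} {p′} p≢p′ =
    matching (suc p′) (suc p) , matching-SOS (p≢p′ ∘ sym ∘ suc-injective) ,
    λ c → sum-difference (edge zero (suc p)) (edge zero (suc p′)) (edge (suc p′) (suc p)) c
      (λ t → cancel (ε (point zero t) c) (ε (point (suc p) t) c) (ε (point (suc p′) t) c))
    where
    cancel : ∀ a b d → (a - b) - (a - d) ≡ d - b
    cancel = solve-∀

  -- The index `t` supplies an actual edge; its second endpoint lies in the block of its own petal,
  -- and the blocks are disjoint.
  petal-distinct : Fin k → ∀ {p p′} → p ≢ p′ → ¬ SameSet (petal p) (petal p′)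
  petal-distinct t {p} {p′} p≢p′ same
    with t′ , eq ← ∈-tabulate⁻ (Equivalence.to (same (edge zero (suc p) t)) (∈-tabulate⁺ t)) =
    p≢p′ (suc-injective (proj₁ (point-injective (suc p) t (suc p′) t′ (cong proj₂ eq))))

  petals-clique : Fin k → SOSClique n k (tabulate petal)
  petals-clique t = record
    { members  = Allₚ.tabulate⁺ (λ p → matching-SOS {zero} {suc p} (λ ()))
    ; distinct = AllPairsₚ.tabulate⁺ (petal-distinct t)
    ; clique   = AllPairsₚ.tabulate⁺ (λ p≢p′ → petal-difference p≢p′ , petal-difference (p≢p′ ∘ sym))
    }

open Nat using (_+_; _*_; _∸_; _^_; _≤_; _<_)

-- Arithmetic linking k 4^k, the threshold and the quotient.

module Thresholds where

  open Natₚ.≤-Reasoning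

  -- The exponent starts at 2 because at k = 1 the inequality would read 6 ≤ 4.
  quadratic≤4^ : ∀ j → 3 + (2 + j) * (2 + j + 2) ≤ 4 ^ (2 + j)
  quadratic≤4^ zero    = Natₚ.m≤m+n 11 5
  quadratic≤4^ (suc j) = begin
    3 + (3 + j) * (3 + j + 2)
      ≤⟨ Natₚ.m≤m+n _ (26 + 16 * j + 3 * (j * j)) ⟩
    3 + (3 + j) * (3 + j + 2) + (26 + 16 * j + 3 * (j * j))
      ≡⟨ slack j ⟩
    4 * (3 + (2 + j) * (2 + j + 2))
      ≤⟨ Natₚ.*-monoʳ-≤ 4 (quadratic≤4^ j) ⟩
    4 ^ (3 + j) ∎
    where
    slack : ∀ j → 3 + (3 + j) * (3 + j + 2) + (26 + 16 * j + 3 * (j * j)) ≡ 4 * (3 + (2 + j) * (2 + j + 2))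
    slack = NatSolver.solve-∀

  -- The left-hand side is the room taken by a kernel and 2 + k (k + 2) petals of k points each, so
  -- the quotient in the theorem reaches the structural threshold.
  large-fits : ∀ k ℓ → .{{_ : NonZero k}} → k * 4 ^ k < ℓ → k + (2 + k * (k + 2)) * k ≤ ℓ + 1
  -- Here 6 ≤ ℓ + 1 is needed, and 4 < ℓ gives exactly that.
  large-fits 1             ℓ h = subst (6 ≤_) (Natₚ.+-comm 1 ℓ) (Nat.s≤s h)
  large-fits k@(suc (suc j)) ℓ h = begin
    k + (2 + k * (k + 2)) * k   ≡⟨ Natₚ.*-comm (3 + k * (k + 2)) k ⟩
    k * (3 + k * (k + 2))       ≤⟨ Natₚ.*-monoʳ-≤ k (quadratic≤4^ j) ⟩
    k * 4 ^ k                   ≤⟨ Natₚ.<⇒≤ h ⟩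
    ℓ                           ≤⟨ Natₚ.m≤m+n ℓ 1 ⟩
    ℓ + 1                       ∎

  fits⇒≤quotient : ∀ k m n → .{{_ : NonZero k}} → k + m * k ≤ n → m ≤ (n ∸ k) / k
  fits⇒≤quotient k m n h = begin
    m             ≡⟨ sym (m*n/n≡m m k) ⟩
    m * k / k     ≤⟨ /-monoˡ-≤ k (Natₚ.m+n≤o⇒m≤o∸n (m * k) (subst (_≤ n) (Natₚ.+-comm k (m * k)) h)) ⟩
    (n ∸ k) / k   ∎

  -- The hypothesis `k ≤ n` excludes truncated subtraction: for n < k the quotient is 0, yet a
  -- single block does not fit.
  quotient-fits : ∀ k n → .{{_ : NonZero k}} → k ≤ n → suc ((n ∸ k) / k) * k ≤ n
  quotient-fits k n k≤n = begin
    k + (n ∸ k) / k * k   ≤⟨ Natₚ.+-monoʳ-≤ k (m/n*n≤m (n ∸ k) k) ⟩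
    k + (n ∸ k)           ≡⟨ Natₚ.m+[n∸m]≡n k≤n ⟩
    n                     ∎

first : ∀ k → .{{_ : NonZero k}} → Fin k
first (suc k) = zero

theorem3p5 : (k ℓ : ℕ) → .{{_ : NonZero k}} → 1 ≤ ℓ →
    ((F : List (List (Root (suc ℓ)))) → SOSClique (suc ℓ) k F → length F ≤ ℓ + 1)
    × (k * 4 ^ k < ℓ →
    (Σ (List (List (Root (suc ℓ)))) λ F → SOSClique (suc ℓ) k F × length F ≡ (ℓ + 1 ∸ k) / k)
    × ((F : List (List (Root (suc ℓ)))) → SOSClique (suc ℓ) k F → length F ≤ (ℓ + 1 ∸ k) / k)
    × ((F : List (List (Root (suc ℓ)))) → SOSClique (suc ℓ) k F → length F ≡ (ℓ + 1 ∸ k) / k → Sunflower F))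
theorem3p5 k ℓ _ = length-bound , λ k4ᵏ<ℓ → attained k4ᵏ<ℓ , maximal k4ᵏ<ℓ , sunflower k4ᵏ<ℓ
  where
  open CliqueProperties
  open Thresholds

  n≡ : suc ℓ ≡ ℓ + 1
  n≡ = Natₚ.+-comm 1 ℓ

  q : ℕ
  q = (ℓ + 1 ∸ k) / k

  length-bound : (F : List (List (Root (suc ℓ)))) → SOSClique (suc ℓ) k F → length F ≤ ℓ + 1
  length-bound F C = subst (length F ≤_) n≡ (length≤n C)

  q-large : k * 4 ^ k < ℓ → 2 + k * (k + 2) ≤ q
  q-large h = fits⇒≤quotient k (2 + k * (k + 2)) (ℓ + 1) (large-fits k ℓ h)

  attained : k * 4 ^ k < ℓ →
             Σ (List (List (Root (suc ℓ)))) λ F → SOSClique (suc ℓ) k F × length F ≡ q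
  attained h = tabulate petal , petals-clique (first k) , length-tabulate petal
    where
    fits : suc q * k ≤ suc ℓ
    fits = subst (suc q * k ≤_) (sym n≡)
      (quotient-fits k (ℓ + 1) (Natₚ.≤-trans (Natₚ.m≤m+n k _) (large-fits k ℓ h)))
    open DisjointBlocks {k = k} {q = q} fits

  maximal : k * 4 ^ k < ℓ → (F : List (List (Root (suc ℓ)))) → SOSClique (suc ℓ) k F → length F ≤ q
  maximal h F C with Natₚ.≤-total (length F) q
  ... | inj₁ small = small
  -- A clique of size at least `q` is above the threshold, so its kernel and petals fit into the
  -- coordinates, which bounds its size by `q`.
  ... | inj₂ q≤    = fits⇒≤quotient k (length F) (ℓ + 1)
    (subst (suc (length F) * k ≤_) n≡ (large⇒fits C (Natₚ.≤-trans (q-large h) q≤)))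

  sunflower : k * 4 ^ k < ℓ → (F : List (List (Root (suc ℓ)))) → SOSClique (suc ℓ) k F →
              length F ≡ q → Sunflower F
  sunflower h F C eq = large⇒sunflower C (subst (2 + k * (k + 2) ≤_) (sym eq) (q-large h))
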